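{- For every $n\ge 2$, the biEulerian polynomial satisfies \[ \frac{B_n(x)}{(1-x)^{2n+1}}=\sum_{k\ge0}\binom{k+2}{2}^n x^k . \]
   Context: A bipermutation of $[n]$ is a sequence $\mathsf{B}=b_1|\cdots|b_{2n-1}$ of elements of $[n]$ in which one element $k=k(\mathsf{B})$ appears exactly once and every other element appears exactly twice. Write first occurrences of each $i\ne k$ as $i$ and second occurrences as $\overline i$; the single occurrence of $k$ is regarded as $k$ when compared with an unbarred letter and as $\overline k$ when compared with a barred letter. Two consecutive letters $i|j$ form a descent if (a) both are unbarred and $i>j$; or (b) both are barred and $i<j$ (comparing underlying numbers); or (c) $i$ is an unbarred element of $[n]\setminus\{k\}$, $j$ is a barred letter $\overline{j'}$ with $j'\ne k$, and $i>k$; or (d) $i$ is barred with $i\ne\overline k$, $j$ is an unbarred element of $[n]\setminus\{k\}$, and $j<k$. The biEulerian polynomial is $B_n(x)=\sum_{i=0}^{2n-2}b(n,i)x^i$, where $b(n,i)$ is the number of bipermutations of $[n]$ with exactly $i$ descents. -}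

module Defs where

open import Data.Nat using (ℕ; zero; suc; _+_; _*_; _∸_; _^_; _≡ᵇ_; _<ᵇ_)
open import Data.Nat.Combinatorics using (_C_)
open import Data.Fin using (Fin; toℕ)
open import Data.List using (List; []; _∷_; [_]; length; map; concatMap; allFin; filterᵇ; foldr)
open import Data.Bool using (Bool; true; false; if_then_else_; _∧_; _∨_)
open import Data.Integer using (ℤ; +_; -[1+_]) renaming (_+_ to _+ℤ_; _*_ to _*ℤ_)

-- Words and bipermutations of [n] (letters are Fin n, i.e. 0..n-1,
-- an order-preserving relabelling of 1..n).

words : (n m : ℕ) → List (List (Fin n))
words n zero    = [ [] ]
words n (suc m) = concatMap (λ x → map (x ∷_) (words n m)) (allFin n)

count : ∀ {n} → ℕ → List (Fin n) → ℕ
count v []       = 0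
count v (y ∷ ys) = if v ≡ᵇ toℕ y then suc (count v ys) else count v ys

allᵇ : {A : Set} → (A → Bool) → List A → Bool
allᵇ p = foldr (λ x r → p x ∧ r) true

isBiperm : (n : ℕ) → List (Fin n) → Bool
isBiperm n w =
  (length w ≡ᵇ (2 * n ∸ 1))
  ∧ allᵇ (λ i → (count (toℕ i) w ≡ᵇ 1) ∨ (count (toℕ i) w ≡ᵇ 2)) (allFin n)
  ∧ (length (filterᵇ (λ i → count (toℕ i) w ≡ᵇ 1) (allFin n)) ≡ᵇ 1)

singleOf : ∀ {n} → List (Fin n) → List (Fin n) → ℕ
singleOf w []       = 0
singleOf w (i ∷ is) = if count (toℕ i) w ≡ᵇ 1 then toℕ i else singleOf w is

kOf : (n : ℕ) → List (Fin n) → ℕ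
kOf n w = singleOf w (allFin n)

-- letter classes: first occurrence i (≠ k), second occurrence ī (≠ k),
-- and the single occurrence of k
data Letter : Set where
  unb : ℕ → Letter
  bar : ℕ → Letter
  kk  : Letter

label : ∀ {n} → ℕ → List (Fin n) → List (Fin n) → List Letter
label k seen []       = []
label k seen (x ∷ xs) =
  (if toℕ x ≡ᵇ k then kk
   else if count (toℕ x) seen ≡ᵇ 0 then unb (toℕ x) else bar (toℕ x))
  ∷ label k (x ∷ seen) xs

-- descent rule (a)-(d); k is regarded as k when compared with an unbarred
-- letter and as k̄ when compared with a barred letter
isDescent : ℕ → Letter → Letter → Bool
isDescent k (unb i) (unb j) = j <ᵇ i
isDescent k (bar i) (bar j) = i <ᵇ j
isDescent k (unb i) kk      = k <ᵇ i
isDescent k kk      (unb j) = j <ᵇ k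
isDescent k (bar i) kk      = i <ᵇ k
isDescent k kk      (bar j) = k <ᵇ j
isDescent k (unb i) (bar j) = k <ᵇ i
isDescent k (bar i) (unb j) = j <ᵇ k
isDescent k kk      kk      = false

countDes : ℕ → List Letter → ℕ
countDes k []           = 0
countDes k (a ∷ [])     = 0
countDes k (a ∷ b ∷ ls) =
  (if isDescent k a b then 1 else 0) + countDes k (b ∷ ls)

des : (n : ℕ) → List (Fin n) → ℕ
des n w = countDes (kOf n w) (label (kOf n w) [] w)

b : ℕ → ℕ → ℕ
b n i = length (filterᵇ (λ w → isBiperm n w ∧ (des n w ≡ᵇ i))
                        (words n (2 * n ∸ 1)))

PowerSeries : Set
PowerSeries = ℕ → ℤ

sumTo : ℕ → (ℕ → ℤ) → ℤ
sumTo zero    f = f 0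
sumTo (suc m) f = sumTo m f +ℤ f (suc m)

_·ₚ_ : PowerSeries → PowerSeries → PowerSeries
(f ·ₚ g) m = sumTo m (λ j → f j *ℤ g (m ∸ j))

sgn : ℕ → ℤ
sgn zero    = + 1
sgn (suc zero) = -[1+ 0 ]
sgn (suc (suc j)) = sgn j

oneMinusXPow : ℕ → PowerSeries
oneMinusXPow e j = sgn j *ℤ (+ (e C j))

biEulerian : ℕ → PowerSeries
biEulerian n i = + (b n i)

rhsSeries : ℕ → PowerSeries
rhsSeries n k = + (((k + 2) C 2) ^ n)

{-# OPTIONS --safe #-}
module Submission where

-- For a fixed single letter k the descent rules are those of an ordinary descent statistic with
-- respect to a total order on the letters:
--   1 < ⋯ < k-1 < n̄ < ⋯ < (k+1)̄ < k < (k-1)̄ < ⋯ < 1̄ < k+1 < ⋯ < n.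
-- If L lists the letters in this order, then the embeddings of a word w of length ℓ with d descents
-- as a subsequence of the (m+1)-fold repetition of L are counted by the coefficient of x^m in
-- x^d / (1-x)^(ℓ+1), because consecutive letters can be taken from the same copy of L exactly at
-- ascents. On the other hand, embedding all the interleavings of the pairs i ī and of k amounts to
-- embedding each pair and k independently. This gives (m+1) C(m+2,2)^(k-1) C(m+1,2)^(n-k)
-- embeddings: a pair with i < k is an ascent, a pair with i > k is a descent. As
-- C(m+2,2) - C(m+1,2) = m+1, the sum over k telescopes to C(m+2,2)^n - C(m+1,2)^n.

open import Defs
open import Data.Bool using (Bool; true; false; if_then_else_; _∧_; _∨_)
open import Data.Bool.Properties using (∧-conicalˡ; ∧-conicalʳ)
open import Data.Fin using (Fin; zero; suc; toℕ; punchIn)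
open import Data.Fin.Properties using (any?; punchInᵢ≢i; toℕ-injective; toℕ<n) renaming (_≟_ to _≟ᶠ_)
open import Data.Integer using (ℤ; +_; -_) renaming (_+_ to _+ℤ_; _*_ to _*ℤ_; _-_ to _-ℤ_)
import Data.Integer.Properties as ℤ
import Data.Integer.Tactic.RingSolver as ℤ-Ring
open import Data.List using (List; []; _∷_; [_]; _++_; map; concatMap; drop; length; tabulate; allFin;
  filterᵇ; applyUpTo; applyDownFrom)
open import Data.List.Properties using (drop-drop)
open import Data.List.Membership.Propositional using (_∈_; _∉_)
open import Data.List.Membership.Propositional.Properties
  using (∈-++⁺ˡ; ∈-++⁺ʳ; ∈-applyUpTo⁺; ∈-applyDownFrom⁺)
open import Data.List.Relation.Unary.All as All using (All; []; _∷_)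
import Data.List.Relation.Unary.All.Properties as All
open import Data.List.Relation.Unary.AllPairs as AllPairs using (AllPairs; []; _∷_)
import Data.List.Relation.Unary.AllPairs.Properties as AllPairs
open import Data.List.Relation.Unary.Any using (here; there)
open import Data.List.Relation.Unary.Unique.Propositional using (Unique)
import Data.List.Relation.Unary.Unique.Propositional.Properties as Unique
open import Data.Maybe as Maybe using (Maybe; just; nothing; maybe)
open import Data.Nat using (ℕ; zero; suc; pred; _+_; _*_; _^_; _∸_; _<_; _≤_; _≡ᵇ_; _<ᵇ_;
  _≟_; _<?_; s≤s)
open import Data.Nat.Combinatorics using (_C_; nC1≡n; nCk+nC[k+1]≡[n+1]C[k+1])
open import Data.Nat.Properties hiding (_≟_; _<?_)
open import Data.Nat.Tactic.RingSolver using (solve-∀)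
open import Data.Product using (∃; _×_; _,_; proj₁; proj₂)
open import Data.Vec.Functional using (updateAt; removeAt)
open import Data.Vec.Functional.Properties using (updateAt-updates; updateAt-minimal)
open import Function using (_∘_; id)
open import Relation.Binary using (DecidableEquality; tri<; tri≈; tri>)
open import Relation.Binary.PropositionalEquality hiding ([_])
open import Relation.Nullary using (Dec; yes; no; does; contradiction; ¬_)
open import Relation.Nullary.Decidable using (dec-true; dec-false)
open import Algebra.Properties.CommutativeMonoid.Sum +-0-commutativeMonoid
  using (sum; sum-remove; sum-cong-≗; ∑-distrib-+; sum-replicate-zero)
open import Algebra.Properties.CommutativeMonoid.Sum *-1-commutativeMonoid
  using () renaming (sum to ∏; sum-remove to ∏-remove; sum-cong-≗ to ∏-cong)
open import Algebra.Properties.Semiring.Sum +-*-semiring using (*-distribˡ-sum)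

private variable
  A B : Set
  n : ℕ

-- Partial sums

S : (ℕ → ℕ) → ℕ → ℕ
S f zero    = f 0
S f (suc m) = f (suc m) + S f m

-- On coefficient sequences `S` is multiplication by 1/(1-x), so `S^ e` is multiplication by
-- 1/(1-x)^e; `shift` below is multiplication by x.
S^ : ℕ → (ℕ → ℕ) → ℕ → ℕ
S^ zero    f = f
S^ (suc e) f = S (S^ e f)

shift : (ℕ → ℕ) → ℕ → ℕ
shift f zero    = 0
shift f (suc m) = f m

S-cong : ∀ {f g} → f ≗ g → S f ≗ S g
S-cong f≗g zero    = f≗g 0
S-cong f≗g (suc m) = cong₂ _+_ (f≗g (suc m)) (S-cong f≗g m)

S^-cong : ∀ e {f g} → f ≗ g → S^ e f ≗ S^ e g
S^-cong zero    f≗g = f≗g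
S^-cong (suc e) f≗g = S-cong (S^-cong e f≗g)

S-shift : ∀ f → S (shift f) ≗ shift (S f)
S-shift f zero          = refl
S-shift f (suc zero)    = +-identityʳ (f 0)
S-shift f (suc (suc m)) = cong (λ z → f (suc m) + z) (S-shift f (suc m))

S^-shift : ∀ e f → S^ e (shift f) ≗ shift (S^ e f)
S^-shift zero    f m = refl
S^-shift (suc e) f m = trans (S-cong (S^-shift e f) m) (S-shift (S^ e f) m)

S-zero : ∀ m → S (λ _ → 0) m ≡ 0
S-zero zero    = refl
S-zero (suc m) = S-zero m

S^-zero : ∀ e m → S^ e (λ _ → 0) m ≡ 0
S^-zero zero    m = refl
S^-zero (suc e) m = trans (S-cong (S^-zero e) m) (S-zero m)

S-+ : ∀ f g m → S (λ j → f j + g j) m ≡ S f m + S g m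
S-+ f g zero    = refl
S-+ f g (suc m) = trans (cong (λ z → f (suc m) + g (suc m) + z) (S-+ f g m))
                        (interchange (f (suc m)) (g (suc m)) (S f m) (S g m))
  where
  interchange : ∀ a b c d → (a + b) + (c + d) ≡ (a + c) + (b + d)
  interchange = solve-∀

S^-+ : ∀ e f g m → S^ e (λ j → f j + g j) m ≡ S^ e f m + S^ e g m
S^-+ zero    f g m = refl
S^-+ (suc e) f g m = trans (S-cong (S^-+ e f g) m) (S-+ (S^ e f) (S^ e g) m)

-- Inverting iterated partial sums by the alternating binomial series

sumTo-cong : ∀ m {f g : ℕ → ℤ} → f ≗ g → sumTo m f ≡ sumTo m g
sumTo-cong zero    f≗g = f≗g 0
sumTo-cong (suc m) f≗g = cong₂ _+ℤ_ (sumTo-cong m f≗g) (f≗g (suc m))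

sumTo-sucˡ : ∀ m (f : ℕ → ℤ) → sumTo (suc m) f ≡ f 0 +ℤ sumTo m (f ∘ suc)
sumTo-sucˡ zero    f = refl
sumTo-sucˡ (suc m) f = trans (cong (_+ℤ f (suc (suc m))) (sumTo-sucˡ m f))
  (ℤ.+-assoc (f 0) (sumTo m (f ∘ suc)) (f (suc (suc m))))

·ₚ-suc : ∀ p g m → (p ·ₚ g) (suc m) ≡ p 0 *ℤ g (suc m) +ℤ ((p ∘ suc) ·ₚ g) m
·ₚ-suc p g m = sumTo-sucˡ m (λ j → p j *ℤ g (suc m ∸ j))

-- The identity (1-x) · `S f` = `f`, multiplied by an arbitrary series `p` and read off at one
-- coefficient. Leaving `p` arbitrary lets the induction peel off its constant term.
·ₚ-S : ∀ p f m → (p ·ₚ (λ j → + S f j)) (suc m) ≡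
                 (p ·ₚ (λ j → + f j)) (suc m) +ℤ (p ·ₚ (λ j → + S f j)) m
·ₚ-S p f zero    = trans (cong (λ z → p 0 *ℤ z +ℤ p 1 *ℤ + f 0) (ℤ.pos-+ (f 1) (f 0)))
                         (rearrange (p 0) (p 1) (+ f 1) (+ f 0))
  where
  rearrange : ∀ a b c d → a *ℤ (c +ℤ d) +ℤ b *ℤ d ≡ (a *ℤ c +ℤ b *ℤ d) +ℤ a *ℤ d
  rearrange = ℤ-Ring.solve-∀
·ₚ-S p f (suc m) = begin
  (p ·ₚ Σf) (2 + m)
    ≡⟨ ·ₚ-suc p Σf (suc m) ⟩
  p 0 *ℤ Σf (2 + m) +ℤ ((p ∘ suc) ·ₚ Σf) (suc m)
    ≡⟨ cong₂ (λ y z → p 0 *ℤ y +ℤ z) (ℤ.pos-+ (f (2 + m)) (S f (suc m))) (·ₚ-S (p ∘ suc) f m) ⟩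
  p 0 *ℤ (+ f (2 + m) +ℤ Σf (suc m)) +ℤ (((p ∘ suc) ·ₚ f⁺) (suc m) +ℤ ((p ∘ suc) ·ₚ Σf) m)
    ≡⟨ rearrange (p 0) (+ f (2 + m)) (Σf (suc m)) _ _ ⟩
  (p 0 *ℤ + f (2 + m) +ℤ ((p ∘ suc) ·ₚ f⁺) (suc m)) +ℤ (p 0 *ℤ Σf (suc m) +ℤ ((p ∘ suc) ·ₚ Σf) m)
    ≡⟨ cong₂ _+ℤ_ (·ₚ-suc p f⁺ (suc m)) (·ₚ-suc p Σf m) ⟨
  (p ·ₚ f⁺) (2 + m) +ℤ (p ·ₚ Σf) (suc m) ∎
  where
  open ≡-Reasoning
  Σf f⁺ : PowerSeries
  Σf j = + S f j
  f⁺ j = + f j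
  rearrange : ∀ a b c x y → a *ℤ (b +ℤ c) +ℤ (x +ℤ y) ≡ (a *ℤ b +ℤ x) +ℤ (a *ℤ c +ℤ y)
  rearrange = ℤ-Ring.solve-∀

·ₚ-distrib-− : ∀ p q g m → ((λ j → p j -ℤ q j) ·ₚ g) m ≡ (p ·ₚ g) m -ℤ (q ·ₚ g) m
·ₚ-distrib-− p q g m = go m m
  where
  distrib : ∀ a b c → (a -ℤ b) *ℤ c ≡ a *ℤ c -ℤ b *ℤ c
  distrib = ℤ-Ring.solve-∀
  step : ∀ x y a b c → (x -ℤ y) +ℤ (a -ℤ b) *ℤ c ≡ (x +ℤ a *ℤ c) -ℤ (y +ℤ b *ℤ c)
  step = ℤ-Ring.solve-∀
  go : ∀ m k → sumTo m (λ j → (p j -ℤ q j) *ℤ g (k ∸ j)) ≡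
               sumTo m (λ j → p j *ℤ g (k ∸ j)) -ℤ sumTo m (λ j → q j *ℤ g (k ∸ j))
  go zero    k = distrib (p 0) (q 0) (g k)
  go (suc m) k = trans (cong (_+ℤ (p (suc m) -ℤ q (suc m)) *ℤ g (k ∸ suc m)) (go m k))
    (step (sumTo m (λ j → p j *ℤ g (k ∸ j))) (sumTo m (λ j → q j *ℤ g (k ∸ j)))
          (p (suc m)) (q (suc m)) (g (k ∸ suc m)))

·ₚ-congˡ : ∀ {p q} g → p ≗ q → p ·ₚ g ≗ q ·ₚ g
·ₚ-congˡ g p≗q m = sumTo-cong m (λ j → cong (_*ℤ g (m ∸ j)) (p≗q j))

sgn-suc : ∀ j → sgn (suc j) ≡ - sgn j
sgn-suc zero          = refl
sgn-suc (suc zero)    = refl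
sgn-suc (suc (suc j)) = sgn-suc j

-- Pascal's rule with signs: (1-x)^(e+1) = (1-x)^e - x(1-x)^e.
oneMinusXPow-suc : ∀ e j → oneMinusXPow (suc e) (suc j) ≡
                           oneMinusXPow e (suc j) -ℤ oneMinusXPow e j
oneMinusXPow-suc e j = begin
  sgn (suc j) *ℤ + (suc e C suc j)
    ≡⟨ cong (λ c → sgn (suc j) *ℤ + c) (nCk+nC[k+1]≡[n+1]C[k+1] e j) ⟨
  sgn (suc j) *ℤ + (e C j + e C suc j)
    ≡⟨ cong₂ _*ℤ_ (sgn-suc j) (ℤ.pos-+ (e C j) (e C suc j)) ⟩
  - sgn j *ℤ (+ (e C j) +ℤ + (e C suc j))
    ≡⟨ rearrange (sgn j) (+ (e C j)) (+ (e C suc j)) ⟩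
  - sgn j *ℤ + (e C suc j) -ℤ oneMinusXPow e j
    ≡⟨ cong (λ s → s *ℤ + (e C suc j) -ℤ oneMinusXPow e j) (sgn-suc j) ⟨
  oneMinusXPow e (suc j) -ℤ oneMinusXPow e j ∎
  where
  open ≡-Reasoning
  rearrange : ∀ s a b → - s *ℤ (a +ℤ b) ≡ - s *ℤ b -ℤ s *ℤ a
  rearrange = ℤ-Ring.solve-∀

oneMinusXPow-suc-·ₚ : ∀ e g m → (oneMinusXPow (suc e) ·ₚ g) (suc m) ≡
                                (oneMinusXPow e ·ₚ g) (suc m) -ℤ (oneMinusXPow e ·ₚ g) m
oneMinusXPow-suc-·ₚ e g m = begin
  (oneMinusXPow (suc e) ·ₚ g) (suc m)
    ≡⟨ ·ₚ-suc (oneMinusXPow (suc e)) g m ⟩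
  a +ℤ ((oneMinusXPow (suc e) ∘ suc) ·ₚ g) m
    ≡⟨ cong (a +ℤ_) (·ₚ-congˡ g (oneMinusXPow-suc e) m) ⟩
  a +ℤ ((λ j → oneMinusXPow e (suc j) -ℤ oneMinusXPow e j) ·ₚ g) m
    ≡⟨ cong (a +ℤ_) (·ₚ-distrib-− (oneMinusXPow e ∘ suc) (oneMinusXPow e) g m) ⟩
  a +ℤ (((oneMinusXPow e ∘ suc) ·ₚ g) m -ℤ (oneMinusXPow e ·ₚ g) m)
    ≡⟨ ℤ.+-assoc a (((oneMinusXPow e ∘ suc) ·ₚ g) m) (- (oneMinusXPow e ·ₚ g) m) ⟨
  (a +ℤ ((oneMinusXPow e ∘ suc) ·ₚ g) m) -ℤ (oneMinusXPow e ·ₚ g) m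
    ≡⟨ cong (_-ℤ (oneMinusXPow e ·ₚ g) m) (·ₚ-suc (oneMinusXPow e) g m) ⟨
  (oneMinusXPow e ·ₚ g) (suc m) -ℤ (oneMinusXPow e ·ₚ g) m ∎
  where
  open ≡-Reasoning
  a : ℤ
  a = oneMinusXPow e 0 *ℤ g (suc m)

oneMinusXPow-suc-S : ∀ e f m → (oneMinusXPow (suc e) ·ₚ (λ j → + S f j)) m ≡
                               (oneMinusXPow e ·ₚ (λ j → + f j)) m
oneMinusXPow-suc-S e f zero    = refl
oneMinusXPow-suc-S e f (suc m) = begin
  (oneMinusXPow (suc e) ·ₚ (λ j → + S f j)) (suc m)
    ≡⟨ oneMinusXPow-suc-·ₚ e (λ j → + S f j) m ⟩
  (oneMinusXPow e ·ₚ (λ j → + S f j)) (suc m) -ℤ y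
    ≡⟨ cong (_-ℤ y) (·ₚ-S (oneMinusXPow e) f m) ⟩
  (x +ℤ y) -ℤ y
    ≡⟨ cancel x y ⟩
  x ∎
  where
  open ≡-Reasoning
  x y : ℤ
  x = (oneMinusXPow e ·ₚ (λ j → + f j)) (suc m)
  y = (oneMinusXPow e ·ₚ (λ j → + S f j)) m
  cancel : ∀ x y → (x +ℤ y) -ℤ y ≡ x
  cancel = ℤ-Ring.solve-∀

oneMinusXPow-zero-·ₚ : ∀ g m → (oneMinusXPow 0 ·ₚ g) m ≡ g m
oneMinusXPow-zero-·ₚ g zero    = ℤ.*-identityˡ (g 0)
oneMinusXPow-zero-·ₚ g (suc m) = trans (·ₚ-suc (oneMinusXPow 0) g m)
  (trans (cong₂ _+ℤ_ (ℤ.*-identityˡ (g (suc m))) (vanish m)) (ℤ.+-identityʳ (g (suc m))))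
  where
  vanish : ∀ m → ((oneMinusXPow 0 ∘ suc) ·ₚ g) m ≡ + 0
  vanish m = go m m
    where
    go : ∀ j k → sumTo j (λ i → oneMinusXPow 0 (suc i) *ℤ g (k ∸ i)) ≡ + 0
    term : ∀ i k → oneMinusXPow 0 (suc i) *ℤ g (k ∸ i) ≡ + 0
    term i k = trans (cong (_*ℤ g (k ∸ i)) (ℤ.*-zeroʳ (sgn (suc i)))) (ℤ.*-zeroˡ (g (k ∸ i)))
    go zero    k = term 0 k
    go (suc j) k = cong₂ _+ℤ_ (go j k) (term (suc j) k)

-- Each factor 1-x undoes one partial summation. This reduces the theorem to an identity of natural
-- numbers for the iterated partial sums of `b n`.
oneMinusXPow-S^ : ∀ e f m → (oneMinusXPow e ·ₚ (λ j → + S^ e f j)) m ≡ + f m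
oneMinusXPow-S^ zero    f m = oneMinusXPow-zero-·ₚ (λ j → + f j) m
oneMinusXPow-S^ (suc e) f m = trans (oneMinusXPow-suc-S e (S^ e f) m) (oneMinusXPow-S^ e f m)

-- Sums over lists and over words

∑ : List A → (A → ℕ) → ℕ
∑ []       f = 0
∑ (x ∷ xs) f = f x + ∑ xs f

∑-cong : ∀ (xs : List A) {f g} → f ≗ g → ∑ xs f ≡ ∑ xs g
∑-cong []       f≗g = refl
∑-cong (x ∷ xs) f≗g = cong₂ _+_ (f≗g x) (∑-cong xs f≗g)

∑-++ : ∀ (xs ys : List A) f → ∑ (xs ++ ys) f ≡ ∑ xs f + ∑ ys f
∑-++ []       ys f = refl
∑-++ (x ∷ xs) ys f = trans (cong (_+_ (f x)) (∑-++ xs ys f)) (sym (+-assoc (f x) (∑ xs f) (∑ ys f)))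

∑-map : ∀ (g : A → B) xs f → ∑ (map g xs) f ≡ ∑ xs (f ∘ g)
∑-map g []       f = refl
∑-map g (x ∷ xs) f = cong (_+_ (f (g x))) (∑-map g xs f)

∑-+ : ∀ (xs : List A) f g → ∑ xs (λ x → f x + g x) ≡ ∑ xs f + ∑ xs g
∑-+ []       f g = refl
∑-+ (x ∷ xs) f g = trans (cong (_+_ (f x + g x)) (∑-+ xs f g)) (interchange (f x) (g x) (∑ xs f) (∑ xs g))
  where
  interchange : ∀ a b c d → (a + b) + (c + d) ≡ (a + c) + (b + d)
  interchange = solve-∀

∑-zero : ∀ (xs : List A) → ∑ xs (λ _ → 0) ≡ 0
∑-zero []       = refl
∑-zero (x ∷ xs) = ∑-zero xs

∑-sum : ∀ (xs : List A) (f : A → Fin n → ℕ) →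
        ∑ xs (λ x → sum (f x)) ≡ sum (λ i → ∑ xs (λ x → f x i))
∑-sum {n = n} []       f = sym (sum-replicate-zero n)
∑-sum         (x ∷ xs) f = trans (cong (_+_ (sum (f x))) (∑-sum xs f))
  (sym (∑-distrib-+ (f x) (λ i → ∑ xs (λ y → f y i))))

S^-∑ : ∀ e (xs : List A) (f : A → ℕ → ℕ) m →
       S^ e (λ j → ∑ xs (λ x → f x j)) m ≡ ∑ xs (λ x → S^ e (f x) m)
S^-∑ e []       f m = S^-zero e m
S^-∑ e (x ∷ xs) f m = trans (S^-+ e (f x) (λ j → ∑ xs (λ y → f y j)) m)
  (cong (_+_ (S^ e (f x) m)) (S^-∑ e xs f m))

S^-sum : ∀ e (f : Fin n → ℕ → ℕ) m → S^ e (λ j → sum (λ i → f i j)) m ≡ sum (λ i → S^ e (f i) m)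
S^-sum {n = zero}  e f m = S^-zero e m
S^-sum {n = suc n} e f m = trans (S^-+ e (f zero) (λ j → sum (λ i → f (suc i) j)) m)
  (cong (_+_ (S^ e (f zero) m)) (S^-sum e (f ∘ suc) m))

∑-words-suc : ∀ n ℓ (f : List (Fin n) → ℕ) →
              ∑ (words n (suc ℓ)) f ≡ sum (λ x → ∑ (words n ℓ) (λ w → f (x ∷ w)))
∑-words-suc n ℓ f = go n id
  where
  -- `allFin n` is `tabulate id`; the induction runs over an arbitrary tabulated function because
  -- the tail of a tabulation is no longer `id`.
  go : ∀ k (g : Fin k → Fin n) →
       ∑ (concatMap (λ x → map (x ∷_) (words n ℓ)) (tabulate g)) f ≡
       sum (λ i → ∑ (words n ℓ) (λ w → f (g i ∷ w)))
  go zero    g = refl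
  go (suc k) g = trans (∑-++ (map (g zero ∷_) (words n ℓ)) _ f)
    (cong₂ _+_ (∑-map (g zero ∷_) (words n ℓ) f) (go k (g ∘ suc)))

∑-words-cong : ∀ n ℓ {f g : List (Fin n) → ℕ} → (∀ w → length w ≡ ℓ → f w ≡ g w) →
               ∑ (words n ℓ) f ≡ ∑ (words n ℓ) g
∑-words-cong n zero    f≗g = cong (_+ 0) (f≗g [] refl)
∑-words-cong n (suc ℓ) {f} {g} f≗g = begin
  ∑ (words n (suc ℓ)) f                        ≡⟨ ∑-words-suc n ℓ f ⟩
  sum (λ x → ∑ (words n ℓ) (λ w → f (x ∷ w)))
    ≡⟨ sum-cong-≗ (λ x → ∑-words-cong n ℓ (λ w ∣w∣≡ℓ → f≗g (x ∷ w) (cong suc ∣w∣≡ℓ))) ⟩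
  sum (λ x → ∑ (words n ℓ) (λ w → g (x ∷ w))) ≡⟨ ∑-words-suc n ℓ g ⟨
  ∑ (words n (suc ℓ)) g                        ∎
  where open ≡-Reasoning

-- Sums and products that differ in a single place

sum-zero : (f : Fin n → ℕ) → (∀ i → f i ≡ 0) → sum f ≡ 0
sum-zero {n} f f≡0 = trans (sum-cong-≗ f≡0) (sum-replicate-zero n)

sum≡0⇒≡0 : (f : Fin n → ℕ) → sum f ≡ 0 → ∀ i → f i ≡ 0
sum≡0⇒≡0 f eq zero    = m+n≡0⇒m≡0 (f zero) eq
sum≡0⇒≡0 f eq (suc i) = sum≡0⇒≡0 (f ∘ suc) (m+n≡0⇒n≡0 (f zero) eq) i

sum-single : ∀ (x : Fin n) (f : Fin n → ℕ) → (∀ i → i ≢ x → f i ≡ 0) → sum f ≡ f x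
sum-single {suc n} x f f≡0 = trans (sum-remove {i = x} f)
  (trans (cong (_+_ (f x)) (sum-zero (removeAt f x) (λ j → f≡0 (punchIn x j) (punchInᵢ≢i x j))))
         (+-identityʳ (f x)))

sum-suc-at : ∀ (x : Fin n) (f g : Fin n → ℕ) → f x ≡ suc (g x) →
             (∀ i → i ≢ x → f i ≡ g i) → sum f ≡ suc (sum g)
sum-suc-at {suc n} x f g fx f≗g = begin
  sum f                            ≡⟨ sum-remove {i = x} f ⟩
  f x + sum (removeAt f x)
    ≡⟨ cong₂ _+_ fx (sum-cong-≗ (λ j → f≗g (punchIn x j) (punchInᵢ≢i x j))) ⟩
  suc (g x + sum (removeAt g x))   ≡⟨ cong suc (sum-remove {i = x} g) ⟨
  suc (sum g)                      ∎
  where open ≡-Reasoning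

-- A product is linear in each single factor. It serves to split the embeddings of one sequence by
-- whether they use or skip the first available letter.
∏-split-at : ∀ (x : Fin n) (f g h : Fin n → ℕ) → f x ≡ g x + h x →
             (∀ i → i ≢ x → f i ≡ g i) → (∀ i → i ≢ x → f i ≡ h i) → ∏ f ≡ ∏ g + ∏ h
∏-split-at {suc n} x f g h fx f≗g f≗h = begin
  ∏ f                                ≡⟨ ∏-remove {i = x} f ⟩
  f x * r                            ≡⟨ cong (_* r) fx ⟩
  (g x + h x) * r                    ≡⟨ *-distribʳ-+ r (g x) (h x) ⟩
  g x * r + h x * r                  ≡⟨ cong₂ (λ y z → g x * y + h x * z) (off f≗g) (off f≗h) ⟩
  g x * ∏ (removeAt g x) + h x * ∏ (removeAt h x)
    ≡⟨ cong₂ _+_ (∏-remove {i = x} g) (∏-remove {i = x} h) ⟨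
  ∏ g + ∏ h                          ∎
  where
  open ≡-Reasoning
  r : ℕ
  r = ∏ (removeAt f x)
  off : ∀ {k : Fin (suc n) → ℕ} → (∀ i → i ≢ x → f i ≡ k i) → r ≡ ∏ (removeAt k x)
  off f≗k = ∏-cong (λ j → f≗k (punchIn x j) (punchInᵢ≢i x j))

-- Interleavings of a family of sequences

advance : Fin n → (Fin n → List A) → Fin n → List A
advance x ch = updateAt ch x (drop 1)

emit : List A → Maybe (List A) → Maybe (List A)
emit []      _ = nothing
emit (a ∷ _) r = Maybe.map (a ∷_) r

-- The word says from which sequence each next letter is taken. Only taking from an exhausted sequence
-- fails; letters may be left over at the end.
interleave : (Fin n → List A) → List (Fin n) → Maybe (List A)
interleave ch []      = just []
interleave ch (x ∷ w) = emit (ch x) (interleave (advance x ch) w)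

total : (Fin n → List A) → ℕ
total ch = sum (length ∘ ch)

total-advance : ∀ (ch : Fin n → List A) x {a as} → ch x ≡ a ∷ as → total ch ≡ suc (total (advance x ch))
total-advance ch x eq = sum-suc-at x (length ∘ ch) (length ∘ advance x ch)
  (trans (cong length eq) (cong (suc ∘ length) (sym (trans (updateAt-updates x ch) (cong (drop 1) eq)))))
  (λ i i≢x → cong length (sym (updateAt-minimal i x ch i≢x)))

-- Failed interleavings get weight 0, so sums can range over all words rather than only over the
-- admissible ones.
weigh : (List A → ℕ) → Maybe (List A) → ℕ
weigh φ = maybe φ 0

weigh-emit-cong : ∀ (φ ψ : List A → ℕ) as r → (∀ {a bs} → as ≡ a ∷ bs → ∀ u → φ (a ∷ u) ≡ ψ (a ∷ u)) →
                  weigh φ (emit as r) ≡ weigh ψ (emit as r)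
weigh-emit-cong φ ψ []       r        eq = refl
weigh-emit-cong φ ψ (a ∷ as) (just u) eq = eq refl u
weigh-emit-cong φ ψ (a ∷ as) nothing  eq = refl

-- Ensures that a given letter can head at most one of the sequences, also after letters have been
-- taken off.
Disjoint : (Fin n → List A) → Set
Disjoint ch = ∀ {i j a} → a ∈ ch i → a ∈ ch j → i ≡ j

∈-drop₁ : ∀ {a : A} as → a ∈ drop 1 as → a ∈ as
∈-drop₁ (_ ∷ _) a∈ = there a∈

∈-advance : ∀ {ch : Fin n → List A} x i {a} → a ∈ advance x ch i → a ∈ ch i
∈-advance {ch = ch} x i a∈ with i ≟ᶠ x
... | yes refl = ∈-drop₁ (ch i) (subst (_ ∈_) (updateAt-updates i ch) a∈)
... | no i≢x   = subst (_ ∈_) (updateAt-minimal i x ch i≢x) a∈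

advance-disjoint : ∀ {ch : Fin n → List A} x → Disjoint ch → Disjoint (advance x ch)
advance-disjoint {ch = ch} x dis a∈i a∈j = dis (∈-advance {ch = ch} x _ a∈i) (∈-advance {ch = ch} x _ a∈j)

-- Counting embeddings of words as subsequences

module Subwords {A : Set} (_≟_ : DecidableEquality A) where

  -- Counts the choices of positions in the second list that spell the first. The two summands are
  -- the embeddings that use the head `t` and those that skip it.
  emb : List A → List A → ℕ
  emb []      ts       = 1
  emb (a ∷ u) []       = 0
  emb (a ∷ u) (t ∷ ts) = (if does (a ≟ t) then emb u ts else 0) + emb (a ∷ u) ts

  emb-≢ : ∀ {a t} u ts → a ≢ t → emb (a ∷ u) (t ∷ ts) ≡ emb (a ∷ u) ts
  emb-≢ {a} {t} u ts a≢t rewrite dec-false (a ≟ t) a≢t = refl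

  emb-≡ : ∀ a u ts → emb (a ∷ u) (a ∷ ts) ≡ emb u ts + emb (a ∷ u) ts
  emb-≡ a u ts rewrite dec-true (a ≟ a) refl = refl

  startsWith? : ∀ t (as : List A) → Dec (∃ λ bs → as ≡ t ∷ bs)
  startsWith? t []       = no λ ()
  startsWith? t (a ∷ as) with a ≟ t
  ... | yes refl = yes (as , refl)
  ... | no a≢t   = no λ { (_ , refl) → a≢t refl }

  emb-¬startsWith : ∀ {t} as ts → ¬ (∃ λ bs → as ≡ t ∷ bs) → emb as (t ∷ ts) ≡ emb as ts
  emb-¬startsWith []       ts _   = refl
  emb-¬startsWith (a ∷ as) ts a≢t = emb-≢ as ts (λ { refl → a≢t (as , refl) })

  ∏-emb-null : (ch : Fin n → List A) → total ch ≡ 0 → ∀ ts → ∏ (λ i → emb (ch i) ts) ≡ 1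
  ∏-emb-null {n = zero}  ch eq ts = refl
  ∏-emb-null {n = suc n} ch eq ts with ch zero
  ... | [] = trans (+-identityʳ _) (∏-emb-null (ch ∘ suc) eq ts)

  ∏-emb-[] : ∀ (ch : Fin n → List A) {ℓ} → suc ℓ ≡ total ch → ∏ (λ i → emb (ch i) []) ≡ 0
  ∏-emb-[] {n = suc n} ch eq with ch zero
  ... | []    = trans (+-identityʳ _) (∏-emb-[] (ch ∘ suc) eq)
  ... | _ ∷ _ = refl

  -- Scanning ts from the left, its first letter is either skipped by all interleaved sequences, or
  -- consumed by the unique one that starts with it.
  ∑-emb-interleave : ∀ ts (ch : Fin n → List A) → Disjoint ch → ∀ ℓ → ℓ ≡ total ch →
    ∑ (words n ℓ) (λ w → weigh (λ u → emb u ts) (interleave ch w)) ≡ ∏ (λ i → emb (ch i) ts)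
  ∑-emb-interleave ts ch dis zero eq = sym (∏-emb-null ch (sym eq) ts)
  ∑-emb-interleave {n} [] ch dis (suc ℓ) eq = begin
    ∑ (words n (suc ℓ)) (λ w → weigh (λ u → emb u []) (interleave ch w))
      ≡⟨ ∑-words-suc n ℓ _ ⟩
    sum (λ x → ∑ (words n ℓ) (λ w → weigh (λ u → emb u []) (interleave ch (x ∷ w))))
      ≡⟨ sum-zero {n = n} _ (λ x → trans
           (∑-cong (words n ℓ) (λ w → weigh-zero (ch x) (interleave (advance x ch) w)))
           (∑-zero (words n ℓ))) ⟩
    0
      ≡⟨ ∏-emb-[] ch eq ⟨
    ∏ (λ i → emb (ch i) []) ∎
    where
    open ≡-Reasoning
    weigh-zero : ∀ as r → weigh (λ u → emb u []) (emit as r) ≡ 0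
    weigh-zero []       r        = refl
    weigh-zero (a ∷ as) (just u) = refl
    weigh-zero (a ∷ as) nothing  = refl
  ∑-emb-interleave {n} (t ∷ ts) ch dis (suc ℓ) eq with any? (λ x → startsWith? t (ch x))
  ... | no none = begin
    ∑ (words n (suc ℓ)) (λ w → weigh (λ u → emb u (t ∷ ts)) (interleave ch w))
      ≡⟨ ∑-words-suc n ℓ _ ⟩
    sum (λ x → ∑ (words n ℓ) (λ w → weigh (λ u → emb u (t ∷ ts)) (interleave ch (x ∷ w))))
      ≡⟨ sum-cong-≗ {n = n} (λ x → ∑-cong (words n ℓ) (λ w →
           weigh-emit-cong _ _ (ch x) (interleave (advance x ch) w)
             (λ {a} {bs} ch-x u → emb-≢ u ts (λ { refl → none (x , bs , ch-x) })))) ⟩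
    sum (λ x → ∑ (words n ℓ) (λ w → weigh (λ u → emb u ts) (interleave ch (x ∷ w))))
      ≡⟨ ∑-words-suc n ℓ _ ⟨
    ∑ (words n (suc ℓ)) (λ w → weigh (λ u → emb u ts) (interleave ch w))
      ≡⟨ ∑-emb-interleave ts ch dis (suc ℓ) eq ⟩
    ∏ (λ i → emb (ch i) ts)
      ≡⟨ ∏-cong {n = n} (λ i → emb-¬startsWith (ch i) ts (λ p → none (i , p))) ⟨
    ∏ (λ i → emb (ch i) (t ∷ ts)) ∎
    where open ≡-Reasoning
  ... | yes (x , bs , ch-x) = begin
    ∑ (words n (suc ℓ)) (λ w → weigh (λ u → emb u (t ∷ ts)) (interleave ch w))
      ≡⟨ ∑-words-suc n ℓ _ ⟩
    sum (λ y → ∑ (words n ℓ) (λ w → weigh (λ u → emb u (t ∷ ts)) (interleave ch (y ∷ w))))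
      ≡⟨ sum-cong-≗ {n = n} (λ y → trans (∑-cong (words n ℓ) (split y)) (∑-+ (words n ℓ) _ _)) ⟩
    sum (λ y → ∑ (words n ℓ) (λ w → weigh (λ u → emb u ts) (interleave ch (y ∷ w))) + consumed y)
      ≡⟨ ∑-distrib-+ {n = n} _ consumed ⟩
    sum (λ y → ∑ (words n ℓ) (λ w → weigh (λ u → emb u ts) (interleave ch (y ∷ w)))) + sum consumed
      ≡⟨ cong₂ _+_ (∑-words-suc n ℓ _) (sym (sum-single x consumed (λ y y≢x →
           trans (∑-cong (words n ℓ) (consumed-≢ y y≢x)) (∑-zero (words n ℓ))))) ⟨
    ∑ (words n (suc ℓ)) (λ w → weigh (λ u → emb u ts) (interleave ch w)) + consumed x
      -- Once `t` has been emitted from sequence `x` and consumed, what remains is an interleaving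
      -- of the advanced family, one letter shorter, to be embedded in `ts`.
      ≡⟨ cong₂ _+_ (∑-emb-interleave ts ch dis (suc ℓ) eq)
           (trans (∑-cong (words n ℓ) consumed-x)
             (∑-emb-interleave ts (advance x ch) (advance-disjoint {ch = ch} x dis) ℓ
               (suc-injective (trans eq (total-advance ch x ch-x))))) ⟩
    ∏ (λ i → emb (ch i) ts) + ∏ (λ i → emb (advance x ch i) ts)
      ≡⟨ +-comm (∏ (λ i → emb (ch i) ts)) _ ⟩
    ∏ (λ i → emb (advance x ch i) ts) + ∏ (λ i → emb (ch i) ts)
      ≡⟨ ∏-split-at x _ _ _ at-x
           (λ i i≢x → trans (elsewhere i i≢x) (cong (λ as → emb as ts) (sym (updateAt-minimal i x ch i≢x))))
           elsewhere ⟨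
    ∏ (λ i → emb (ch i) (t ∷ ts)) ∎
    where
    open ≡-Reasoning
    -- The part of `emb u (t ∷ ts)` in which `t` is used as the first letter of the word;
    -- `weigh-split` separates it from the part that skips `t`.
    consume : List A → ℕ
    consume []      = 0
    consume (a ∷ u) = if does (a ≟ t) then emb u ts else 0
    consumed : Fin n → ℕ
    consumed y = ∑ (words n ℓ) (λ w → weigh consume (interleave ch (y ∷ w)))
    weigh-split : ∀ as r → weigh (λ u → emb u (t ∷ ts)) (emit as r) ≡
                           weigh (λ u → emb u ts) (emit as r) + weigh consume (emit as r)
    weigh-split []       r        = refl
    weigh-split (a ∷ as) (just u) = +-comm (consume (a ∷ u)) (emb (a ∷ u) ts)
    weigh-split (a ∷ as) nothing  = refl
    split : ∀ y w → weigh (λ u → emb u (t ∷ ts)) (interleave ch (y ∷ w)) ≡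
                    weigh (λ u → emb u ts) (interleave ch (y ∷ w)) + weigh consume (interleave ch (y ∷ w))
    split y w = weigh-split (ch y) (interleave (advance y ch) w)
    t∈ch-x : t ∈ ch x
    t∈ch-x = subst (t ∈_) (sym ch-x) (here refl)
    other : ∀ y → y ≢ x → ¬ (∃ λ cs → ch y ≡ t ∷ cs)
    other y y≢x (cs , ch-y) = y≢x (dis (subst (t ∈_) (sym ch-y) (here refl)) t∈ch-x)
    consumed-≢ : ∀ y → y ≢ x → ∀ w → weigh consume (interleave ch (y ∷ w)) ≡ 0
    consumed-≢ y y≢x w = go (ch y) (other y y≢x) (interleave (advance y ch) w)
      where
      go : ∀ as → ¬ (∃ λ cs → as ≡ t ∷ cs) → ∀ r → weigh consume (emit as r) ≡ 0
      go []       _   r        = refl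
      go (a ∷ as) a≢t nothing  = refl
      go (a ∷ as) a≢t (just u) rewrite dec-false (a ≟ t) (λ { refl → a≢t (as , refl) }) = refl
    consumed-x : ∀ w → weigh consume (interleave ch (x ∷ w)) ≡
                       weigh (λ u → emb u ts) (interleave (advance x ch) w)
    consumed-x w = go (ch x) ch-x (interleave (advance x ch) w)
      where
      go : ∀ as → as ≡ t ∷ bs → ∀ r → weigh consume (emit as r) ≡ weigh (λ u → emb u ts) r
      go _ refl nothing  = refl
      go _ refl (just u) rewrite dec-true (t ≟ t) refl = refl
    at-x : emb (ch x) (t ∷ ts) ≡ emb (advance x ch x) ts + emb (ch x) ts
    at-x rewrite updateAt-updates x {drop 1} ch | ch-x = emb-≡ t bs ts
    elsewhere : ∀ i → i ≢ x → emb (ch i) (t ∷ ts) ≡ emb (ch i) ts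
    elsewhere i i≢x = emb-¬startsWith (ch i) ts (other i i≢x)

-- Letters of a successful interleaving

interleave-length : ∀ (ch : Fin n → List A) w {u} → interleave ch w ≡ just u → length u ≡ length w
interleave-length ch []      refl = refl
interleave-length ch (x ∷ w) eq with ch x | interleave (advance x ch) w in rest | eq
... | a ∷ as | just u | refl = cong suc (interleave-length (advance x ch) w rest)

interleave-⊆ : ∀ (ch : Fin n → List A) w {u} → interleave ch w ≡ just u → All (λ a → ∃ λ i → a ∈ ch i) u
interleave-⊆ ch []      refl = []
interleave-⊆ ch (x ∷ w) eq with ch x in ch-x | interleave (advance x ch) w in rest | eq
... | a ∷ as | just u | refl =
  (x , subst (a ∈_) (sym ch-x) (here refl)) ∷
  All.map (λ (i , c∈) → i , ∈-advance {ch = ch} x i c∈) (interleave-⊆ (advance x ch) w rest)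

-- An emitted letter cannot recur: its own sequence has no repetitions, and the other sequences are
-- disjoint from it. `S^-countDes` needs this distinctness.
interleave-unique : ∀ (ch : Fin n → List A) → Disjoint ch → (∀ i → Unique (ch i)) →
                    ∀ w {u} → interleave ch w ≡ just u → Unique u
interleave-unique ch dis uniq []      refl = []
interleave-unique {n} {A} ch dis uniq (x ∷ w) eq with ch x in ch-x | interleave (advance x ch) w in rest | eq
... | a ∷ as | just u | refl =
  All.map fresh (interleave-⊆ (advance x ch) w rest) ∷
  interleave-unique (advance x ch) (advance-disjoint {ch = ch} x dis) uniq′ w rest
  where
  a∷as-unique : Unique (a ∷ as)
  a∷as-unique = subst Unique ch-x (uniq x)
  fresh : ∀ {c} → (∃ λ i → c ∈ advance x ch i) → a ≢ c
  fresh (i , c∈) refl with i ≟ᶠ x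
  ... | no i≢x   = i≢x (dis (∈-advance {ch = ch} x i c∈) (subst (a ∈_) (sym ch-x) (here refl)))
  ... | yes refl with AllPairs.head a∷as-unique
  ...   | a∉as = All.lookup a∉as (subst (a ∈_) (trans (updateAt-updates x ch) (cong (drop 1) ch-x)) c∈) refl
  uniq′ : ∀ i → Unique (advance x ch i)
  uniq′ i with i ≟ᶠ x
  ... | yes refl = subst Unique (sym (updateAt-updates i ch)) (Unique.drop⁺ 1 (uniq i))
  ... | no i≢x   = subst Unique (sym (updateAt-minimal i x ch i≢x)) (uniq i)

-- Descents and embeddings into repeated copies of an ordered list

_≟ᴸ_ : DecidableEquality Letter
unb i ≟ᴸ unb j with i ≟ j
... | yes refl = yes refl
... | no i≢j   = no λ { refl → i≢j refl }
bar i ≟ᴸ bar j with i ≟ j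
... | yes refl = yes refl
... | no i≢j   = no λ { refl → i≢j refl }
kk    ≟ᴸ kk    = yes refl
unb _ ≟ᴸ bar _ = no λ ()
unb _ ≟ᴸ kk    = no λ ()
bar _ ≟ᴸ unb _ = no λ ()
bar _ ≟ᴸ kk    = no λ ()
kk    ≟ᴸ unb _ = no λ ()
kk    ≟ᴸ bar _ = no λ ()

open Subwords _≟ᴸ_

-- The coefficients of the monomial x^d.
ind : ℕ → ℕ → ℕ
ind d j = if d ≡ᵇ j then 1 else 0

ind-suc : ∀ d → ind (suc d) ≗ shift (ind d)
ind-suc d zero    = refl
ind-suc d (suc j) = refl

S-ind-zero : ∀ m → S (ind 0) m ≡ 1
S-ind-zero zero    = refl
S-ind-zero (suc m) = S-ind-zero m

emb-skip : ∀ {b} u K ts → b ∉ K → emb (b ∷ u) (K ++ ts) ≡ emb (b ∷ u) ts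
emb-skip u []      ts b∉ = refl
emb-skip u (c ∷ K) ts b∉ = trans (emb-≢ u (K ++ ts) (b∉ ∘ here)) (emb-skip u K ts (b∉ ∘ there))

after : Letter → List Letter → List Letter
after a []      = []
after a (c ∷ K) = if does (a ≟ᴸ c) then K else after a K

copies : List Letter → ℕ → List Letter
copies L zero    = []
copies L (suc m) = L ++ copies L m

module Ascending (k : ℕ) where

  -- Both directions are recorded, so that the positions of two distinct letters in an ascending
  -- list decide whether they form a descent in either order. Ascending lists require this of all
  -- pairs, hence no transitivity proof arises.
  _⊏_ : Letter → Letter → Set
  a ⊏ b = isDescent k a b ≡ false × isDescent k b a ≡ true

  ⊏-irrefl : ∀ a → ¬ (a ⊏ a)
  ⊏-irrefl a (p , q) with trans (sym p) q
  ... | ()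

  ∉-tail : ∀ {c K} → All (c ⊏_) K → c ∉ K
  ∉-tail {c} c⊏ c∈ = ⊏-irrefl c (All.lookup c⊏ c∈)

  -- An ascending list contains `a` once. Either that occurrence is used, leaving the letters after
  -- it, or the whole of `L` is skipped.
  emb-after : ∀ {a L} u ts → AllPairs _⊏_ L → a ∈ L →
              emb (a ∷ u) (L ++ ts) ≡ emb u (after a L ++ ts) + emb (a ∷ u) ts
  emb-after {a} {c ∷ K} u ts (c⊏ ∷ asc) a∈ with a ≟ᴸ c | a∈
  ... | yes refl | _         = cong (_+_ (emb u (K ++ ts))) (emb-skip u K ts (∉-tail c⊏))
  ... | no a≢c   | here eq   = contradiction eq a≢c
  ... | no a≢c   | there a∈K = emb-after u ts asc a∈K

  -- If `b` stood before `a` in `L`, the two would form a descent; so `b` stands after `a`, and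
  -- discarding the letters up to `a` loses no place for it. Equal letters are excluded because they
  -- form no descent although a copy of `L` offers the letter only once.
  emb-after-ascent : ∀ {a b L} u ts → AllPairs _⊏_ L → a ∈ L → b ∈ L → a ≢ b → isDescent k a b ≡ false →
                     emb (b ∷ u) (after a L ++ ts) ≡ emb (b ∷ u) (L ++ ts)
  emb-after-ascent {a} {b} {c ∷ K} u ts (c⊏ ∷ asc) a∈ b∈ a≢b a⊏b with a ≟ᴸ c | a∈ | b∈
  ... | yes refl | _         | _         = sym (emb-≢ u (K ++ ts) (≢-sym a≢b))
  ... | no a≢c   | here eq   | _         = contradiction eq a≢c
  ... | no a≢c   | there a∈K | here refl with trans (sym a⊏b) (proj₂ (All.lookup c⊏ a∈K))
  ...   | ()
  emb-after-ascent {a} {b} {c ∷ K} u ts (c⊏ ∷ asc) a∈ b∈ a≢b a⊏b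
      | no a≢c   | there a∈K | there b∈K = trans (emb-after-ascent u ts asc a∈K b∈K a≢b a⊏b)
    (sym (emb-≢ u (K ++ ts) (λ { refl → ∉-tail c⊏ b∈K })))

  -- If `b` stood after `a` in `L`, the pair would not be a descent. So the rest of the current copy
  -- is useless for `b`.
  emb-after-descent : ∀ {a b L} u ts → AllPairs _⊏_ L → a ∈ L → isDescent k a b ≡ true →
                      emb (b ∷ u) (after a L ++ ts) ≡ emb (b ∷ u) ts
  emb-after-descent {a} {b} {c ∷ K} u ts (c⊏ ∷ asc) a∈ a⊐b with a ≟ᴸ c | a∈
  ... | yes refl | _         = emb-skip u K ts
    (λ b∈K → contradiction (trans (sym a⊐b) (proj₁ (All.lookup c⊏ b∈K))) λ ())
  ... | no a≢c   | here eq   = contradiction eq a≢c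
  ... | no a≢c   | there a∈K = emb-after-descent u ts asc a∈K a⊐b

  -- Sums over the copy of `L` in which `a` is placed; `j` is the number of whole copies left after
  -- it.
  emb-copies : ∀ {a L} u → AllPairs _⊏_ L → a ∈ L → ∀ m →
               emb (a ∷ u) (copies L (suc m)) ≡ S (λ j → emb u (after a L ++ copies L j)) m
  emb-copies u asc a∈ zero    = trans (emb-after u [] asc a∈) (+-identityʳ _)
  emb-copies {a} {L} u asc a∈ (suc m) = trans (emb-after u (copies L (suc m)) asc a∈)
    (cong (_+_ (emb u (after a L ++ copies L (suc m)))) (emb-copies u asc a∈ m))

  -- The letters of an embedded word come from successive copies of L, and two consecutive ones may
  -- come from the same copy exactly when they form an ascent.
  S^-countDes : ∀ {L} → AllPairs _⊏_ L → ∀ a u → All (_∈ L) (a ∷ u) → Unique (a ∷ u) → ∀ m →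
                S^ (2 + length u) (ind (countDes k (a ∷ u))) m ≡ emb (a ∷ u) (copies L (suc m))
  S^-countDes {L} asc a [] (a∈ ∷ []) _ m = trans (S-cong S-ind-zero m) (sym (emb-copies [] asc a∈ m))
  S^-countDes {L} asc a (b ∷ u) (a∈ ∷ b∈ ∷ u∈) ((a≢b ∷ _) ∷ uniq) m =
    trans (S-cong step m) (sym (emb-copies (b ∷ u) asc a∈ m))
    where
    d : ℕ
    d = countDes k (b ∷ u)
    rec : S^ (2 + length u) (ind d) ≗ λ j → emb (b ∷ u) (copies L (suc j))
    rec = S^-countDes asc b u (b∈ ∷ u∈) uniq
    -- A descent forces the next letter into a later copy, which costs one copy; with none left,
    -- both sides are 0.
    shifted : ∀ j → shift (S^ (2 + length u) (ind d)) j ≡ emb (b ∷ u) (copies L j)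
    shifted zero    = refl
    shifted (suc j) = rec j
    step : ∀ j → S^ (2 + length u) (ind (countDes k (a ∷ b ∷ u))) j ≡ emb (b ∷ u) (after a L ++ copies L j)
    step j with isDescent k a b in eq
    ... | false = trans (rec j) (sym (emb-after-ascent u (copies L j) asc a∈ b∈ a≢b eq))
    ... | true  = begin
      S^ (2 + length u) (ind (suc d)) j        ≡⟨ S^-cong (2 + length u) (ind-suc d) j ⟩
      S^ (2 + length u) (shift (ind d)) j      ≡⟨ S^-shift (2 + length u) (ind d) j ⟩
      shift (S^ (2 + length u) (ind d)) j      ≡⟨ shifted j ⟩
      emb (b ∷ u) (copies L j)                 ≡⟨ emb-after-descent u (copies L j) asc a∈ eq ⟨
      emb (b ∷ u) (after a L ++ copies L j)    ∎
      where open ≡-Reasoning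

  -- Carries `S^-countDes` over to interleavings, failures being 0 on both sides. The length has the
  -- form `suc ℓ` because `S^-countDes` speaks of nonempty words.
  S^-weigh : ∀ {L} → AllPairs _⊏_ L → (ch : Fin n → List Letter) → Disjoint ch → (∀ i → Unique (ch i)) →
             (∀ i → All (_∈ L) (ch i)) → ∀ w {ℓ} → length w ≡ suc ℓ → ∀ m →
             S^ (2 + ℓ) (λ j → weigh (λ u → ind (countDes k u) j) (interleave ch w)) m ≡
             weigh (λ u → emb u (copies L (suc m))) (interleave ch w)
  S^-weigh asc ch dis uniq ⊆L w {ℓ} len m with interleave ch w in eq
  ... | nothing = S^-zero (2 + ℓ) m
  ... | just u with u | trans (interleave-length ch w eq) len
                | All.map (λ (i , a∈) → All.lookup (⊆L i) a∈) (interleave-⊆ ch w eq)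
                | interleave-unique ch dis uniq w eq
  ...   | a ∷ v | refl | a∷v∈L | a∷v-unique = S^-countDes asc a v a∷v∈L a∷v-unique m

-- The total order on letters whose descents are those of the theorem

order : ℕ → ℕ → List Letter
order k h = applyUpTo unb k ++ applyDownFrom (λ j → bar (suc k + j)) h ++
            kk ∷ applyDownFrom bar k ++ applyUpTo (λ j → unb (suc k + j)) h

module _ (k : ℕ) where
  open Ascending k

  -- Compares letters within each of the five blocks and then each block with all later ones. Every
  -- comparison comes down to one strict inequality between two numbers, at times via `k`.
  order-ascending : ∀ h → AllPairs _⊏_ (order k h)
  order-ascending h =
    AllPairs.++⁺ (AllPairs.applyUpTo⁺₁ unb k (λ i<j _ → <ᵇ-asym i<j))
      (AllPairs.++⁺ (AllPairs.applyDownFrom⁺₁ barʰ h (λ j<i _ → <ᵇ-asym (+-monoʳ-< (suc k) j<i)))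
        (All.++⁺ (All.applyDownFrom⁺₁ bar k <ᵇ-asym) (All.applyUpTo⁺₁ unbʰ h (λ {i} _ → <ᵇ-asym (k<k+1+ i)))
         ∷ AllPairs.++⁺ (AllPairs.applyDownFrom⁺₁ bar k (λ j<i _ → <ᵇ-asym j<i))
                        (AllPairs.applyUpTo⁺₁ unbʰ h (λ i<j _ → <ᵇ-asym (+-monoʳ-< (suc k) i<j)))
                        (All.applyDownFrom⁺₁ bar k (λ {j} _ → bar⊏unbʰ j)))
        (All.applyDownFrom⁺₁ barʰ h (λ {j} _ →
          <ᵇ-asym (k<k+1+ j) ∷
          All.++⁺ (All.applyDownFrom⁺₁ bar k (λ i<k → <ᵇ-asym (<-trans i<k (k<k+1+ j))))
                  (bar⊏unbʰ (suc k + j)))))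
      (All.applyUpTo⁺₁ unb k (λ i<k →
        All.++⁺ (All.applyDownFrom⁺₁ barʰ h (λ _ → <ᵇ-asym i<k))
          (<ᵇ-asym i<k ∷
           All.++⁺ (All.applyDownFrom⁺₁ bar k (λ _ → <ᵇ-asym i<k))
                   (All.applyUpTo⁺₁ unbʰ h (λ {j} _ → <ᵇ-asym (<-trans i<k (k<k+1+ j)))))))
    where
    barʰ unbʰ : ℕ → Letter
    barʰ j = bar (suc k + j)
    unbʰ j = unb (suc k + j)
    k<k+1+ : ∀ i → k < suc k + i
    k<k+1+ i = m≤m+n (suc k) i
    <ᵇ-asym : ∀ {i j} → i < j → (j <ᵇ i) ≡ false × (i <ᵇ j) ≡ true
    <ᵇ-asym {i} {j} i<j = dec-false (j <? i) (<⇒≯ i<j) , dec-true (i <? j) i<j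
    bar⊏unbʰ : ∀ j → All (bar j ⊏_) (applyUpTo unbʰ h)
    bar⊏unbʰ j = All.applyUpTo⁺₁ unbʰ h (λ {i} _ → <ᵇ-asym (k<k+1+ i))

  kk∈order : ∀ h → kk ∈ order k h
  kk∈order h = ∈-++⁺ʳ (applyUpTo unb k) (∈-++⁺ʳ (applyDownFrom (λ j → bar (suc k + j)) h) (here refl))

  private
    above : ∀ {h i} (f : ℕ → Letter) {K} → (∀ {j} → j < h → f (suc k + j) ∈ K) → k < i → i < suc k + h → f i ∈ K
    above {h} {i} f {K} in-K k<i i<n =
      subst (λ j → f j ∈ K) (m+[n∸m]≡n k<i)
        (in-K (+-cancelˡ-< (suc k) _ _ (subst (_< suc k + h) (sym (m+[n∸m]≡n k<i)) i<n)))

  unb∈order : ∀ {h i} → i < suc k + h → i ≢ k → unb i ∈ order k h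
  unb∈order {h} {i} i<n i≢k with <-cmp i k
  ... | tri< i<k _ _ = ∈-++⁺ˡ (∈-applyUpTo⁺ unb i<k)
  ... | tri≈ _ i≡k _ = contradiction i≡k i≢k
  ... | tri> _ _ k<i = ∈-++⁺ʳ (applyUpTo unb k)
    (∈-++⁺ʳ (applyDownFrom (λ j → bar (suc k + j)) h) (there (∈-++⁺ʳ (applyDownFrom bar k)
      (above unb (∈-applyUpTo⁺ (λ j → unb (suc k + j))) k<i i<n))))

  bar∈order : ∀ {h i} → i < suc k + h → i ≢ k → bar i ∈ order k h
  bar∈order {h} {i} i<n i≢k with <-cmp i k
  ... | tri< i<k _ _ = ∈-++⁺ʳ (applyUpTo unb k)
    (∈-++⁺ʳ (applyDownFrom (λ j → bar (suc k + j)) h) (there (∈-++⁺ˡ (∈-applyDownFrom⁺ bar i<k))))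
  ... | tri≈ _ i≡k _ = contradiction i≡k i≢k
  ... | tri> _ _ k<i = ∈-++⁺ʳ (applyUpTo unb k) (∈-++⁺ˡ
    (above bar (∈-applyDownFrom⁺ (λ j → bar (suc k + j))) k<i i<n))

-- Multiplicities

≡ᵇ-refl : ∀ (i : Fin n) → (toℕ i ≡ᵇ toℕ i) ≡ true
≡ᵇ-refl i = dec-true (toℕ i ≟ toℕ i) refl

≢⇒≡ᵇ-false : ∀ {i j : Fin n} → i ≢ j → (toℕ i ≡ᵇ toℕ j) ≡ false
≢⇒≡ᵇ-false {i = i} {j} i≢j = dec-false (toℕ i ≟ toℕ j) (i≢j ∘ toℕ-injective)

count-≡ : ∀ (x : Fin n) w → count (toℕ x) (x ∷ w) ≡ suc (count (toℕ x) w)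
count-≡ x w rewrite ≡ᵇ-refl x = refl

count-≢ : ∀ {i x : Fin n} w → i ≢ x → count (toℕ i) (x ∷ w) ≡ count (toℕ i) w
count-≢ w i≢x rewrite ≢⇒≡ᵇ-false i≢x = refl

-- With exact multiplicities no sequence is ever exhausted too early. Conversely, in
-- `interleave-count` the length condition rules out leftover letters, so success forces the
-- multiplicities.
interleave-complete : ∀ (ch : Fin n → List A) w → (∀ i → count (toℕ i) w ≡ length (ch i)) →
                      ∃ λ u → interleave ch w ≡ just u
interleave-complete ch []      eq = [] , refl
interleave-complete ch (x ∷ w) eq with ch x in ch-x | eq x
... | []     | eq-x = contradiction (trans (sym (count-≡ x w)) eq-x) λ ()
... | a ∷ as | eq-x with interleave-complete (advance x ch) w rest
  where
  rest : ∀ i → count (toℕ i) w ≡ length (advance x ch i)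
  rest i with i ≟ᶠ x
  ... | yes refl = trans (suc-injective (trans (sym (count-≡ x w)) eq-x))
                         (cong length (sym (trans (updateAt-updates x ch) (cong (drop 1) ch-x))))
  ... | no i≢x   = trans (sym (count-≢ w i≢x)) (trans (eq i) (cong length (sym (updateAt-minimal i x ch i≢x))))
...   | u , eq-u = a ∷ u , cong (Maybe.map (a ∷_)) eq-u

interleave-count : ∀ (ch : Fin n → List A) w {u} → length w ≡ total ch → interleave ch w ≡ just u →
                   ∀ i → count (toℕ i) w ≡ length (ch i)
interleave-count ch []      len _ i = sym (sum≡0⇒≡0 (length ∘ ch) (sym len) i)
interleave-count ch (x ∷ w) len eq i with ch x in ch-x | interleave (advance x ch) w in rest | eq
... | a ∷ as | just u | refl with interleave-count (advance x ch) w
                                    (suc-injective (trans len (total-advance ch x ch-x))) rest i | i ≟ᶠ x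
...   | rec | no i≢x   = trans (count-≢ w i≢x) (trans rec (cong length (updateAt-minimal i x ch i≢x)))
...   | rec | yes refl = trans (count-≡ x w) (trans (cong suc rec)
  (trans (cong (suc ∘ length) (trans (updateAt-updates x ch) (cong (drop 1) ch-x))) (cong length (sym ch-x))))

-- The letters of a bipermutation

-- The labelled letters contributed by `i` when `k` is the single letter, in the forced order: first
-- occurrence before second.
chain : Fin n → Fin n → List Letter
chain k i = if toℕ i ≡ᵇ toℕ k then [ kk ] else unb (toℕ i) ∷ bar (toℕ i) ∷ []

chain-elim : ∀ {k i : Fin n} (P : List Letter → Set) → (i ≡ k → P [ kk ]) →
             (i ≢ k → P (unb (toℕ i) ∷ bar (toℕ i) ∷ [])) → P (chain k i)
chain-elim {k = k} {i} P P-kk P-pair with i ≟ᶠ k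
... | yes refl rewrite ≡ᵇ-refl i     = P-kk refl
... | no i≢k   rewrite ≢⇒≡ᵇ-false i≢k = P-pair i≢k

mult : Fin n → Fin n → ℕ
mult k i = if toℕ i ≡ᵇ toℕ k then 1 else 2

length-chain : ∀ (k i : Fin n) → length (chain k i) ≡ mult k i
length-chain k i with toℕ i ≡ᵇ toℕ k
... | true  = refl
... | false = refl

mult-≡ : ∀ (k : Fin n) → mult k k ≡ 1
mult-≡ k rewrite ≡ᵇ-refl k = refl

mult-≢ : ∀ {k i : Fin n} → i ≢ k → mult k i ≡ 2
mult-≢ i≢k rewrite ≢⇒≡ᵇ-false i≢k = refl

total-chain : ∀ (k : Fin n) → total (chain k) ≡ 2 * n ∸ 1
total-chain {n} k = begin
  total (chain k)           ≡⟨ sum-cong-≗ (length-chain k) ⟩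
  sum (mult k)              ≡⟨ cong pred (sum-suc-at k (λ _ → 2) (mult k) (sym (cong suc (mult-≡ k)))
                                                      (λ i i≢k → sym (mult-≢ i≢k))) ⟨
  pred (sum {n} (λ _ → 2))  ≡⟨ cong pred (trans (twos n) (*-comm n 2)) ⟩
  2 * n ∸ 1                 ∎
  where
  open ≡-Reasoning
  twos : ∀ n → sum {n} (λ _ → 2) ≡ n * 2
  twos zero    = refl
  twos (suc n) = cong (_+_ 2) (twos n)

chain-disjoint : ∀ (k : Fin n) → Disjoint (chain k)
chain-disjoint {n} k a∈i a∈j = toℕ-injective (trans (sym (All.lookup (owned _) a∈i)) (All.lookup (owned _) a∈j))
  where
  owner : Letter → ℕ
  owner (unb i) = i
  owner (bar i) = i
  owner kk      = toℕ k
  owned : ∀ i → All (λ a → owner a ≡ toℕ i) (chain k i)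
  owned i = chain-elim (All (λ a → owner a ≡ toℕ i)) (λ { refl → refl ∷ [] }) (λ _ → refl ∷ refl ∷ [])

chain-unique : ∀ (k i : Fin n) → Unique (chain k i)
chain-unique k i = chain-elim Unique (λ _ → [] ∷ []) (λ _ → ((λ ()) ∷ []) ∷ [] ∷ [])

orderOf : Fin n → List Letter
orderOf {n} k = order (toℕ k) (n ∸ suc (toℕ k))

chain⊆order : ∀ (k i : Fin n) → All (_∈ orderOf k) (chain k i)
chain⊆order {n} k i = chain-elim (All (_∈ orderOf k)) (λ _ → kk∈order (toℕ k) h ∷ [])
  (λ i≢k → unb∈order (toℕ k) i< (i≢k ∘ toℕ-injective) ∷ bar∈order (toℕ k) i< (i≢k ∘ toℕ-injective) ∷ [])
  where
  h : ℕ
  h = n ∸ suc (toℕ k)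
  i< : toℕ i < suc (toℕ k) + h
  i< = subst (toℕ i <_) (sym (m+[n∸m]≡n (toℕ<n k))) (toℕ<n i)

-- The invariant is that the chain of `i` has lost one letter for each occurrence of `i` already
-- seen. Its head is then the label that the next occurrence receives.
interleave-label : ∀ (k : Fin n) seen (ch : Fin n → List Letter) →
                   (∀ i → ch i ≡ drop (count (toℕ i) seen) (chain k i)) →
                   ∀ w {u} → interleave ch w ≡ just u → u ≡ label (toℕ k) seen w
interleave-label k seen ch inv []      refl = refl
interleave-label k seen ch inv (x ∷ w) eq with ch x in ch-x | interleave (advance x ch) w in rest | eq
... | a ∷ as | just u | refl =
  cong₂ _∷_ (first (toℕ x ≡ᵇ toℕ k) (count (toℕ x) seen) (trans (sym ch-x) (inv x)))
            (interleave-label k (x ∷ seen) (advance x ch) inv′ w rest)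
  where
  first : ∀ β c → a ∷ as ≡ drop c (if β then [ kk ] else unb (toℕ x) ∷ bar (toℕ x) ∷ []) →
          a ≡ (if β then kk else if c ≡ᵇ 0 then unb (toℕ x) else bar (toℕ x))
  first true  zero                refl = refl
  first true  (suc zero)          ()
  first true  (suc (suc c))       ()
  first false zero                refl = refl
  first false (suc zero)          refl = refl
  first false (suc (suc zero))    ()
  first false (suc (suc (suc c))) ()
  inv′ : ∀ i → advance x ch i ≡ drop (count (toℕ i) (x ∷ seen)) (chain k i)
  inv′ i with i ≟ᶠ x
  ... | no i≢x   = trans (updateAt-minimal i x ch i≢x)
    (trans (inv i) (cong (λ c → drop c (chain k i)) (sym (count-≢ seen i≢x))))
  ... | yes refl = begin
    advance x ch x                                   ≡⟨ updateAt-updates x ch ⟩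
    drop 1 (ch x)                                    ≡⟨ cong (drop 1) (inv x) ⟩
    drop 1 (drop (count (toℕ x) seen) (chain k x))   ≡⟨ drop-drop (count (toℕ x) seen) 1 (chain k x) ⟩
    drop (count (toℕ x) seen + 1) (chain k x)
      ≡⟨ cong (λ c → drop c (chain k x)) (trans (+-comm _ 1) (sym (count-≡ x seen))) ⟩
    drop (count (toℕ x) (x ∷ seen)) (chain k x)      ∎
    where open ≡-Reasoning

-- Bipermutations by their single letter

Biperm : Fin n → List (Fin n) → Set
Biperm k w = ∀ i → count (toℕ i) w ≡ mult k i

length-filterᵇ : ∀ (p : A → Bool) xs → length (filterᵇ p xs) ≡ ∑ xs (λ x → if p x then 1 else 0)
length-filterᵇ p []       = refl
length-filterᵇ p (x ∷ xs) with p x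
... | true  = cong suc (length-filterᵇ p xs)
... | false = length-filterᵇ p xs

∑-tabulate : ∀ (g : Fin n → A) f → ∑ (tabulate g) f ≡ sum (f ∘ g)
∑-tabulate {n = zero}  g f = refl
∑-tabulate {n = suc n} g f = cong (_+_ (f (g zero))) (∑-tabulate (g ∘ suc) f)

sum-bits≡1 : ∀ (p : Fin n → Bool) → sum (λ i → if p i then 1 else 0) ≡ 1 →
             ∃ λ (k : Fin n) → ∀ i → p i ≡ (toℕ i ≡ᵇ toℕ k)
sum-bits≡1 {suc n} p eq with p zero in p₀
... | true  = zero , λ { zero → p₀ ; (suc i) → bit≡0 (p (suc i)) (sum≡0⇒≡0 _ (suc-injective eq) i) }
  where
  bit≡0 : ∀ β → (if β then 1 else 0) ≡ 0 → β ≡ false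
  bit≡0 false _ = refl
... | false with sum-bits≡1 (p ∘ suc) eq
...   | k , single = suc k , λ { zero → p₀ ; (suc i) → single i }

allᵇ-tabulate⁻ : ∀ (p : A → Bool) (g : Fin n → A) → allᵇ p (tabulate g) ≡ true → ∀ i → p (g i) ≡ true
allᵇ-tabulate⁻ p g eq zero    = ∧-conicalˡ _ _ eq
allᵇ-tabulate⁻ p g eq (suc i) = allᵇ-tabulate⁻ p (g ∘ suc) (∧-conicalʳ (p (g zero)) _ eq) i

allᵇ-tabulate⁺ : ∀ (p : A → Bool) (g : Fin n → A) → (∀ i → p (g i) ≡ true) → allᵇ p (tabulate g) ≡ true
allᵇ-tabulate⁺ {n = zero}  p g eq = refl
allᵇ-tabulate⁺ {n = suc n} p g eq = cong₂ _∧_ (eq zero) (allᵇ-tabulate⁺ p (g ∘ suc) (eq ∘ suc))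

Biperm-once : ∀ {k : Fin n} {w} → Biperm k w → ∀ i → (count (toℕ i) w ≡ᵇ 1) ≡ (toℕ i ≡ᵇ toℕ k)
Biperm-once {k = k} {w} bp i rewrite bp i with toℕ i ≡ᵇ toℕ k
... | true  = refl
... | false = refl

Biperm-functional : ∀ {j k : Fin n} {w} → Biperm j w → Biperm k w → j ≡ k
Biperm-functional {j = j} {k} bj bk with j ≟ᶠ k
... | yes j≡k = j≡k
... | no j≢k  = contradiction (trans (sym (mult-≡ j)) (trans (sym (bj j)) (trans (bk j) (mult-≢ j≢k)))) λ ()

isBiperm⇒Biperm : ∀ (w : List (Fin n)) → isBiperm n w ≡ true → ∃ λ k → Biperm k w
isBiperm⇒Biperm {n} w eq = k , λ i → trans (once-or-twice _ (allᵇ-tabulate⁻ _ id (∧-conicalˡ _ _ eq′) i))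
                                           (cong (if_then 1 else 2) (single i))
  where
  eq′ : _ ≡ true
  eq′ = ∧-conicalʳ (length w ≡ᵇ (2 * n ∸ 1)) _ eq
  once : Fin n → Bool
  once i = count (toℕ i) w ≡ᵇ 1
  one-single : sum (λ i → if once i then 1 else 0) ≡ 1
  one-single = trans (sym (trans (length-filterᵇ once (allFin n)) (∑-tabulate {n = n} id _)))
                     (≡ᵇ⇒≡′ (length (filterᵇ once (allFin n))) (∧-conicalʳ _ _ eq′))
    where
    ≡ᵇ⇒≡′ : ∀ c → (c ≡ᵇ 1) ≡ true → c ≡ 1
    ≡ᵇ⇒≡′ 1 _ = refl
  k : Fin n
  k = proj₁ (sum-bits≡1 once one-single)
  single : ∀ i → once i ≡ (toℕ i ≡ᵇ toℕ k)
  single = proj₂ (sum-bits≡1 once one-single)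
  once-or-twice : ∀ c → ((c ≡ᵇ 1) ∨ (c ≡ᵇ 2)) ≡ true → c ≡ (if c ≡ᵇ 1 then 1 else 2)
  once-or-twice 1 _ = refl
  once-or-twice 2 _ = refl
  once-or-twice (suc (suc (suc c))) ()

Biperm⇒isBiperm : ∀ {k : Fin n} {w} → length w ≡ 2 * n ∸ 1 → Biperm k w → isBiperm n w ≡ true
Biperm⇒isBiperm {n} {k} {w} len bp = cong₂ _∧_ (dec-true (length w ≟ 2 * n ∸ 1) len)
  (cong₂ _∧_ (allᵇ-tabulate⁺ _ id once-or-twice) (cong (_≡ᵇ 1) one-single))
  where
  once-or-twice : ∀ i → ((count (toℕ i) w ≡ᵇ 1) ∨ (count (toℕ i) w ≡ᵇ 2)) ≡ true
  once-or-twice i rewrite bp i with toℕ i ≡ᵇ toℕ k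
  ... | true  = refl
  ... | false = refl
  bit : Bool → ℕ
  bit = if_then 1 else 0
  one-single : length (filterᵇ (λ i → count (toℕ i) w ≡ᵇ 1) (allFin n)) ≡ 1
  one-single = begin
    length (filterᵇ (λ i → count (toℕ i) w ≡ᵇ 1) (allFin n))  ≡⟨ length-filterᵇ _ (allFin n) ⟩
    ∑ (allFin n) (λ i → bit (count (toℕ i) w ≡ᵇ 1))            ≡⟨ ∑-tabulate {n = n} id _ ⟩
    sum {n} (λ i → bit (count (toℕ i) w ≡ᵇ 1))
      ≡⟨ sum-cong-≗ {n = n} (λ i → cong bit (Biperm-once {k = k} {w} bp i)) ⟩
    sum {n} (λ i → bit (toℕ i ≡ᵇ toℕ k))
      ≡⟨ sum-single k (λ i → bit (toℕ i ≡ᵇ toℕ k)) (λ i i≢k → cong bit (≢⇒≡ᵇ-false i≢k)) ⟩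
    bit (toℕ k ≡ᵇ toℕ k)                                      ≡⟨ cong bit (≡ᵇ-refl k) ⟩
    1                                                         ∎
    where open ≡-Reasoning

kOf-Biperm : ∀ (k : Fin n) w → Biperm k w → kOf n w ≡ toℕ k
kOf-Biperm {n} k w bp = go id k refl
  where
  -- The scan passes over every entry other than `k`, since only `k` has multiplicity 1.
  go : ∀ {l} (g : Fin l → Fin n) x → g x ≡ k → singleOf w (tabulate g) ≡ toℕ k
  go {suc l} g x gx≡k with g zero ≟ᶠ k
  ... | yes g₀≡k rewrite Biperm-once {k = k} {w} bp (g zero) | g₀≡k | ≡ᵇ-refl k = refl
  go {suc l} g zero    gx≡k | no g₀≢k = contradiction gx≡k g₀≢k
  go {suc l} g (suc x) gx≡k | no g₀≢k
    rewrite Biperm-once {k = k} {w} bp (g zero) | ≢⇒≡ᵇ-false g₀≢k = go (g ∘ suc) x gx≡k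

-- On words of length 2n-1 this is the indicator of being a bipermutation with single letter `k` and
-- `m` descents.
descents : Fin n → ℕ → List (Fin n) → ℕ
descents k m w = weigh (λ u → ind (countDes (toℕ k) u) m) (interleave (chain k) w)

descents-Biperm : ∀ {k : Fin n} {w} → Biperm k w → ∀ m → descents k m w ≡ ind (des n w) m
descents-Biperm {k = k} {w} bp m
  with interleave-complete (chain k) w (λ i → trans (bp i) (sym (length-chain k i)))
... | u , eq rewrite eq | interleave-label k [] (chain k) (λ _ → refl) w eq | kOf-Biperm k w bp = refl

descents-¬Biperm : ∀ (k : Fin n) w → length w ≡ 2 * n ∸ 1 → ¬ Biperm k w → ∀ m → descents k m w ≡ 0
descents-¬Biperm k w len ¬bp m with interleave (chain k) w in eq
... | nothing = refl
... | just u  = contradiction (λ i → trans (interleave-count (chain k) w (trans len (sym (total-chain k))) eq i)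
                                           (length-chain k i)) ¬bp

-- The single letter is determined by the word, so at most one summand on the right is nonzero.
isBiperm-descents : ∀ m (w : List (Fin n)) → length w ≡ 2 * n ∸ 1 →
                    (if isBiperm n w ∧ (des n w ≡ᵇ m) then 1 else 0) ≡ sum (λ k → descents k m w)
isBiperm-descents {n} m w len with isBiperm n w in eq
... | false = sym (sum-zero {n = n} _ (λ k → descents-¬Biperm k w len
        (λ bp → contradiction (trans (sym (Biperm⇒isBiperm {k = k} {w} len bp)) eq) λ ()) m))
... | true with isBiperm⇒Biperm w eq
...   | k , bp = sym (trans
        (sum-single k (λ j → descents j m w)
          (λ j j≢k → descents-¬Biperm j w len (λ bp′ → j≢k (Biperm-functional {w = w} bp′ bp)) m))
        (descents-Biperm {w = w} bp m))

b-∑ : ∀ n m → b n m ≡ sum (λ k → ∑ (words n (2 * n ∸ 1)) (descents k m))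
b-∑ n m = trans (length-filterᵇ _ (words n (2 * n ∸ 1)))
  (trans (∑-words-cong n (2 * n ∸ 1) (isBiperm-descents m)) (∑-sum (words n (2 * n ∸ 1)) (λ w k → descents k m w)))

-- Summation over the single letter

-- The coefficients of 1/(1-x)^2 and 1/(1-x)^3, that is m+1 and C(m+2,2). Accordingly `shift T m` is
-- C(m+1,2), including the value 0 at m = 0.
D T : ℕ → ℕ
D = S^ 2 (ind 0)
T = S^ 3 (ind 0)

D-suc : ∀ m → D m ≡ suc m
D-suc zero    = refl
D-suc (suc m) = cong₂ _+_ (S-ind-zero m) (D-suc m)

T-binomial : ∀ m → T m ≡ (m + 2) C 2
T-binomial zero    = refl
T-binomial (suc m) = begin
  D (suc m) + T m             ≡⟨ cong₂ _+_ (trans (D-suc (suc m)) (+-comm 2 m)) (T-binomial m) ⟩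
  (m + 2) + (m + 2) C 2       ≡⟨ cong (_+ (m + 2) C 2) (nC1≡n (m + 2)) ⟨
  (m + 2) C 1 + (m + 2) C 2   ≡⟨ nCk+nC[k+1]≡[n+1]C[k+1] (m + 2) 1 ⟩
  (suc m + 2) C 2             ∎
  where open ≡-Reasoning

T-split : ∀ m → T m ≡ D m + shift T m
T-split zero    = refl
T-split (suc m) = refl

-- The embedding count of the letters from `i`, for `d` = m+1 and `c` = C(m+1,2): `d` for the single
-- letter, `c` for a pair above it, `d + c` for a pair below it.
factor : ℕ → ℕ → Fin n → Fin n → ℕ
factor c d k i = if toℕ i ≡ᵇ toℕ k then d else if toℕ k <ᵇ toℕ i then c else d + c

∏-const : ∀ n c → ∏ {n} (λ _ → c) ≡ c ^ n
∏-const zero    c = refl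
∏-const (suc n) c = cong (c *_) (∏-const n c)

telescope : ∀ n c d → (d + c) ^ n ≡ sum (λ k → ∏ (factor {n} c d k)) + c ^ n
telescope zero    c d = refl
telescope (suc n) c d = begin
  (d + c) * (d + c) ^ n               ≡⟨ cong ((d + c) *_) (telescope n c d) ⟩
  (d + c) * (Σ∏ + c ^ n)              ≡⟨ rearrange d c Σ∏ (c ^ n) ⟩
  (d * c ^ n + (d + c) * Σ∏) + c ^ suc n
    ≡⟨ cong₂ (λ x y → (d * x + y) + c ^ suc n) (sym (∏-const n c))
         (*-distribˡ-sum (d + c) (λ k → ∏ (factor {n} c d k))) ⟩
  -- This sum unfolds by the place of `k`: if `k` is the least letter, all others lie above it and
  -- give `d * c ^ n`; otherwise the least letter contributes `d + c` and the rest is the case `n`.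
  sum (λ k → ∏ (factor {suc n} c d k)) + c ^ suc n ∎
  where
  open ≡-Reasoning
  Σ∏ : ℕ
  Σ∏ = sum (λ k → ∏ (factor {n} c d k))
  rearrange : ∀ d c x y → (d + c) * (x + y) ≡ (d * y + (d + c) * x) + c * y
  rearrange = solve-∀

-- Reads `S^-countDes` backwards on a word of one or two letters: the single letter gives `D`, an
-- ascending pair gives `T`, and a descending pair gives `shift T`.
emb-chain : ∀ (k i : Fin n) m → emb (chain k i) (copies (orderOf k) (suc m)) ≡ factor (shift T m) (D m) k i
emb-chain {n} k i m with i ≟ᶠ k
... | yes refl rewrite ≡ᵇ-refl i = sym (S^-countDes asc kk [] (kk∈order (toℕ k) _ ∷ []) ([] ∷ []) m)
  where
  open Ascending (toℕ k)
  asc : AllPairs _⊏_ (orderOf k)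
  asc = order-ascending (toℕ k) (n ∸ suc (toℕ k))
... | no i≢k rewrite ≢⇒≡ᵇ-false i≢k = trans
  (sym (S^-countDes asc (unb (toℕ i)) (bar (toℕ i) ∷ [])
         (subst (All (_∈ orderOf k)) pair (chain⊆order k i)) (((λ ()) ∷ []) ∷ [] ∷ []) m))
  descent-or-ascent
  where
  open Ascending (toℕ k)
  asc : AllPairs _⊏_ (orderOf k)
  asc = order-ascending (toℕ k) (n ∸ suc (toℕ k))
  pair : chain k i ≡ unb (toℕ i) ∷ bar (toℕ i) ∷ []
  pair rewrite ≢⇒≡ᵇ-false i≢k = refl
  descent-or-ascent : S^ 3 (ind (countDes (toℕ k) (unb (toℕ i) ∷ bar (toℕ i) ∷ []))) m ≡
                      (if toℕ k <ᵇ toℕ i then shift T m else D m + shift T m)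
  descent-or-ascent with toℕ k <ᵇ toℕ i
  ... | true  = trans (S^-cong 3 (ind-suc 0) m) (S^-shift 3 (ind 0) m)
  ... | false = T-split m

S^-descents : ∀ (k : Fin n) m → S^ (2 * n) (λ j → ∑ (words n (2 * n ∸ 1)) (descents k j)) m ≡
                                ∏ (factor (shift T m) (D m) k)
S^-descents {n@(suc p)} k m = begin
  S^ (2 * n) (λ j → ∑ W (descents k j)) m
    ≡⟨ S^-∑ (2 * n) W (λ w j → descents k j w) m ⟩
  ∑ W (λ w → S^ (2 * n) (λ j → descents k j w) m)
    ≡⟨ ∑-words-cong n (2 * n ∸ 1) summed ⟩
  ∑ W (λ w → weigh (λ u → emb u (copies (orderOf k) (suc m))) (interleave (chain k) w))
    ≡⟨ ∑-emb-interleave (copies (orderOf k) (suc m)) (chain k) (chain-disjoint k)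
         (2 * n ∸ 1) (sym (total-chain k)) ⟩
  ∏ (λ i → emb (chain k i) (copies (orderOf k) (suc m)))
    ≡⟨ ∏-cong (λ i → emb-chain k i m) ⟩
  ∏ (factor (shift T m) (D m) k) ∎
  where
  open ≡-Reasoning
  open Ascending (toℕ k)
  W : List (List (Fin n))
  W = words n (2 * n ∸ 1)
  -- Exhibits the word length as a successor, which makes the exponent `2 + ℓ` of `S^-weigh` equal
  -- to 2n.
  2n-1 : 2 * n ∸ 1 ≡ suc (p + (p + 0))
  2n-1 = +-suc p (p + 0)
  summed : ∀ w → length w ≡ 2 * n ∸ 1 → S^ (2 * n) (λ j → descents k j w) m ≡
           weigh (λ u → emb u (copies (orderOf k) (suc m))) (interleave (chain k) w)
  summed w len = trans (cong (λ e → S^ (suc e) (λ j → descents k j w) m) 2n-1)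
    (S^-weigh (order-ascending (toℕ k) (n ∸ suc (toℕ k))) (chain k) (chain-disjoint k) (chain-unique k)
      (chain⊆order k) w (trans len 2n-1) m)

S^-b : ∀ n → 2 ≤ n → ∀ m → S^ (suc (2 * n)) (b n) m ≡ T m ^ n
S^-b n 2≤n m = trans (S-cong once m) (telescoped m)
  where
  once : ∀ j → S^ (2 * n) (b n) j ≡ sum (λ k → ∏ (factor {n} (shift T j) (D j) k))
  once j = trans (S^-cong (2 * n) (b-∑ n) j)
    (trans (S^-sum {n} (2 * n) (λ k i → ∑ (words n (2 * n ∸ 1)) (descents k i)) j)
           (sum-cong-≗ {n} (λ k → S^-descents k j)))
  power : ∀ j → T j ^ n ≡ sum (λ k → ∏ (factor {n} (shift T j) (D j) k)) + shift T j ^ n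
  power j = trans (cong (_^ n) (T-split j)) (telescope n (shift T j) (D j))
  -- The last partial summation telescopes down to m = 0, where the remaining term is a power of
  -- `shift T 0`, which is 0.
  0^n : ∀ {n} → 2 ≤ n → 0 ^ n ≡ 0
  0^n (s≤s _) = refl
  telescoped : ∀ m → S (λ j → sum (λ k → ∏ (factor {n} (shift T j) (D j) k))) m ≡ T m ^ n
  telescoped zero    = sym (trans (power 0) (trans (cong (_+_ _) (0^n 2≤n)) (+-identityʳ _)))
  telescoped (suc m) = trans (cong (_+_ _) (telescoped m)) (sym (power (suc m)))

theorem6p2 : (n : ℕ) → 2 ≤ n →
    (m : ℕ) → biEulerian n m ≡ (oneMinusXPow (2 * n + 1) ·ₚ rhsSeries n) m
theorem6p2 n 2≤n m = begin
  + b n m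
    ≡⟨ oneMinusXPow-S^ (suc (2 * n)) (b n) m ⟨
  (oneMinusXPow (suc (2 * n)) ·ₚ (λ j → + S^ (suc (2 * n)) (b n) j)) m
    ≡⟨ sumTo-cong m (λ j → cong₂ (λ e r → oneMinusXPow e j *ℤ + r) (+-comm 1 (2 * n))
         (trans (S^-b n 2≤n (m ∸ j)) (cong (_^ n) (T-binomial (m ∸ j))))) ⟩
  (oneMinusXPow (2 * n + 1) ·ₚ rhsSeries n) m ∎
  where open ≡-Reasoning
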